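{- For all integers $n> r\ge 1$, it holds that $T(n,r+1,r)\le \frac{6.239}{r+1}\binom{n}{r}$. Moreover, there is an integer $r_0$ such that for all integers $n>r\ge r_0$, it holds that $T(n,r+1,r)\le \frac{4.911}{r+1}\binom{n}{r}$.
   Context: An $r$-graph on a vertex set $V$ is a collection of $r$-subsets of $V$ (edges). For positive integers $n\ge s>r$, a Turán $(n,s,r)$-system is an $r$-graph $G$ on an $n$-element set $V$ such that every $s$-subset $X\subseteq V$ contains at least one edge of $G$. The Turán number $T(n,s,r)$ is the minimum number of edges of a Turán $(n,s,r)$-system. -}

module Defs where

open import Data.Nat using (ℕ; _≡ᵇ_)
open import Data.Fin.Subset using (Subset; ∣_∣; _⊆_)
open import Data.List using (List; length)
open import Data.List.Relation.Unary.All using (All)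
open import Data.List.Relation.Unary.Any using (Any)
open import Data.List.Relation.Unary.Unique.Propositional using (Unique)
open import Data.Product using (_×_; Σ)
open import Relation.Binary.PropositionalEquality using (_≡_)

IsRGraph : (n r : ℕ) → List (Subset n) → Set
IsRGraph n r G = Unique G × All (λ e → ∣ e ∣ ≡ r) G

IsTuranSystem : (n s r : ℕ) → List (Subset n) → Set
IsTuranSystem n s r G =
  IsRGraph n r G × ((X : Subset n) → ∣ X ∣ ≡ s → Any (λ e → e ⊆ X) G)

-- T(n,s,r) ≤ m  (T is the minimum number of edges of a Turán system,
-- so this says some Turán (n,s,r)-system has at most m edges).
-- Here the bound is given as a rational num/den, i.e. T * den ≤ num.
TuranLeFrac : (n s r num den : ℕ) → Set
TuranLeFrac n s r num den =
  Σ (List (Subset n)) λ G → IsTuranSystem n s r G × (length G Data.Nat.* den Data.Nat.≤ num)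
  where import Data.Nat

{-# OPTIONS --safe #-}
module Submission where

-- Write D(s) for the supremum over n of the least density of a Turán
-- (n,s,s-1)-system.  Then D(j+s) ≤ p + (1-p)^j D(s) for all j and p ∈ [0,1].
-- Indeed, order the n points and select subsets at random with probability p.
-- Let X be an edge if its first j-1 points form a selected set; the expected
-- density of such X is p.  A (j+s)-set Y then contains an edge unless its first
-- j points are isolated, i.e. none of the j sets obtained from them by deleting
-- a point is selected; this has probability (1-p)^j.  To cover such Y, let X also
-- be an edge if its first j points are isolated and its remaining s-1 points are
-- an edge of an optimal system on the points that follow.
--
-- With p = 1/s and j = c s the recursion reads, for large s,
-- N D(N) ≤ (1+c)(1 + e^{-c} s D(s)) where N = j+s.  At c = 5/2 this is a
-- contraction whose fixed point is about 4.9109.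

open import Defs
open import Data.Bool using (Bool; true; false; not; _∧_; _∨_; T; T?)
open import Data.Bool.Properties using (T-∧; T-∨)
open import Data.Fin.Subset using (Subset; ∣_∣; _⊆_; ⊥; inside; outside)
open import Data.Fin.Subset.Properties using (s⊆s; out⊆; ⊆-refl; ⊥⊆; ∣⊥∣≡0)
open import Data.List using (List; []; _∷_; _++_; map; length; filter)
open import Data.List.Properties using (map-++; map-∘; length-map; length-++)
open import Data.List.Membership.Propositional using (_∈_; lose)
open import Data.List.Membership.Propositional.Properties using (∈-++⁺ˡ; ∈-++⁺ʳ; ∈-map⁺; ∈-map⁻; ∈-filter⁺)
open import Data.List.Relation.Unary.All as All using (All; []; _∷_)
import Data.List.Relation.Unary.All.Properties as Allₚ
open import Data.List.Relation.Unary.Any using (here)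
open import Data.List.Relation.Unary.AllPairs using ([]; _∷_)
open import Data.List.Relation.Unary.Unique.Propositional using (Unique)
import Data.List.Relation.Unary.Unique.Propositional.Properties as Uniqueₚ
open import Data.Nat
open import Data.Nat.Combinatorics using (_C_; nCk+nC[k+1]≡[n+1]C[k+1])
open import Data.Nat.DivMod using (_/_; _%_; m≡m%n+[m/n]*n; m%n<n; m/n*n≤m; /-monoˡ-≤; m*n/n≡m)
open import Data.Nat.Induction using (<-rec)
open import Data.Nat.ListAction using (sum)
open import Data.Nat.ListAction.Properties using (sum-++)
open import Data.Nat.Properties
open import Data.Nat.Tactic.RingSolver using (solve-∀)
open import Data.Product using (_×_; Σ; ∃; _,_; proj₁; proj₂)
open import Data.Sum using (inj₁; inj₂)
open import Data.Unit using (tt)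
open import Data.Vec using ([]; _∷_)
open import Data.Vec.Properties using (∷-injectiveʳ)
open import Function using (_∘_; _$_; it; Equivalence)
open import Relation.Binary.PropositionalEquality
open import Relation.Nullary using (yes; no)

-- Enumeration of the r-subsets of [n], and finite sums

-- The recursion is Pascal's rule, so counts over r-subsets obey the same induction as the binomial
-- coefficients.
subsets : (n r : ℕ) → List (Subset n)
subsets zero    zero    = [] ∷ []
subsets zero    (suc r) = []
subsets (suc n) zero    = map (outside ∷_) (subsets n zero)
subsets (suc n) (suc r) = map (inside ∷_) (subsets n r) ++ map (outside ∷_) (subsets n (suc r))

∈-subsets : ∀ {n} (X : Subset n) → X ∈ subsets n ∣ X ∣
∈-subsets []           = here refl
∈-subsets (true  ∷ X) = ∈-++⁺ˡ (∈-map⁺ _ (∈-subsets X))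
∈-subsets (false ∷ X) = go ∣ X ∣ (∈-subsets X)
  where
  go : ∀ r → X ∈ subsets _ r → (false ∷ X) ∈ subsets _ r
  go zero    X∈ = ∈-map⁺ _ X∈
  go (suc r) X∈ = ∈-++⁺ʳ (map (inside ∷_) (subsets _ r)) (∈-map⁺ _ X∈)

subsets-size : ∀ n r → All (λ X → ∣ X ∣ ≡ r) (subsets n r)
subsets-size zero    zero    = refl ∷ []
subsets-size zero    (suc r) = []
subsets-size (suc n) zero    = Allₚ.map⁺ (subsets-size n zero)
subsets-size (suc n) (suc r) =
  Allₚ.++⁺ (Allₚ.map⁺ (All.map (cong suc) (subsets-size n r))) (Allₚ.map⁺ (subsets-size n (suc r)))

subsets-unique : ∀ n r → Unique (subsets n r)
subsets-unique zero    zero    = [] ∷ []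
subsets-unique zero    (suc r) = []
subsets-unique (suc n) zero    = Uniqueₚ.map⁺ ∷-injectiveʳ (subsets-unique n zero)
subsets-unique (suc n) (suc r) =
  Uniqueₚ.++⁺ (Uniqueₚ.map⁺ ∷-injectiveʳ (subsets-unique n r))
              (Uniqueₚ.map⁺ ∷-injectiveʳ (subsets-unique n (suc r)))
              disjoint
  where
  disjoint : ∀ {X} → X ∈ map (inside ∷_) (subsets n r) × X ∈ map (outside ∷_) (subsets n (suc r)) → _
  disjoint (p , q) with _ , _ , refl ← ∈-map⁻ _ p with _ , _ , () ← ∈-map⁻ _ q

length-subsets : ∀ n r → length (subsets n r) ≡ n C r
length-subsets zero    zero    = refl
length-subsets zero    (suc r) = refl
length-subsets (suc n) zero    = trans (length-map _ (subsets n zero)) (length-subsets n zero)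
length-subsets (suc n) (suc r) = begin
  length (map (inside ∷_) (subsets n r) ++ map (outside ∷_) (subsets n (suc r)))
    ≡⟨ length-++ (map (inside ∷_) (subsets n r)) ⟩
  length (map (inside ∷_) (subsets n r)) + length (map (outside ∷_) (subsets n (suc r)))
    ≡⟨ cong₂ _+_ (length-map _ (subsets n r)) (length-map _ (subsets n (suc r))) ⟩
  length (subsets n r) + length (subsets n (suc r))
    ≡⟨ cong₂ _+_ (length-subsets n r) (length-subsets n (suc r)) ⟩
  n C r + n C suc r
    ≡⟨ nCk+nC[k+1]≡[n+1]C[k+1] n r ⟩
  suc n C suc r ∎
  where open ≡-Reasoning

∑ : {A : Set} → (A → ℕ) → List A → ℕ
∑ f xs = sum (map f xs)

∑-subsets : ∀ n r (f : Subset (suc n) → ℕ) →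
            ∑ f (subsets (suc n) (suc r)) ≡ ∑ (f ∘ (inside ∷_)) (subsets n r) + ∑ (f ∘ (outside ∷_)) (subsets n (suc r))
∑-subsets n r f = begin
  sum (map f (xs ++ ys))          ≡⟨ cong sum (map-++ f xs ys) ⟩
  sum (map f xs ++ map f ys)      ≡⟨ sum-++ (map f xs) (map f ys) ⟩
  sum (map f xs) + sum (map f ys) ≡⟨ cong₂ (λ as bs → sum as + sum bs) (map-∘ (subsets n r)) (map-∘ (subsets n (suc r))) ⟨
  _ ∎
  where
  open ≡-Reasoning
  xs = map (inside ∷_) (subsets n r)
  ys = map (outside ∷_) (subsets n (suc r))

∑-mono : {A : Set} {f g : A → ℕ} {xs : List A} → All (λ x → f x ≤ g x) xs → ∑ f xs ≤ ∑ g xs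
∑-mono []             = z≤n
∑-mono (fx≤gx ∷ f≤g) = +-mono-≤ fx≤gx (∑-mono f≤g)

∑-affine : {A : Set} (k l : ℕ) (f : A → ℕ) (xs : List A) → ∑ (λ x → k + l * f x) xs ≡ k * length xs + l * ∑ f xs
∑-affine k l f []       = sym (cong₂ _+_ (*-zeroʳ k) (*-zeroʳ l))
∑-affine k l f (x ∷ xs) = trans (cong (k + l * f x +_) (∑-affine k l f xs)) (poly k l (f x) (length xs) (∑ f xs))
  where
  poly : ∀ k l x n y → k + l * x + (k * n + l * y) ≡ k * suc n + l * (x + y)
  poly = solve-∀

ι : Bool → ℕ
ι true  = 1
ι false = 0

ι-∧ : ∀ x y → ι (x ∧ y) ≡ ι x * ι y
ι-∧ true  y = sym (+-identityʳ (ι y))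
ι-∧ false y = refl

ι-∨ : ∀ x y → ι (x ∨ y) ≤ ι x + ι y
ι-∨ true  y = s≤s z≤n
ι-∨ false y = ≤-refl

length-filter-T : {A : Set} (g : A → Bool) (xs : List A) → length (filter (T? ∘ g) xs) ≡ ∑ (ι ∘ g) xs
length-filter-T g []       = refl
length-filter-T g (x ∷ xs) with g x
... | true  = cong suc (length-filter-T g xs)
... | false = length-filter-T g xs

-- Random sets of subsets

-- A family on `suc n` points consists of two families on n points: `f` governs the sets containing
-- the first point, `g` those avoiding it. Under random selection the two halves are independent.
combine : ∀ {n} → (Subset n → Bool) → (Subset n → Bool) → Subset (suc n) → Bool
combine f g (true  ∷ X) = f X
combine f g (false ∷ X) = g X

-- 𝔼 F / weight is the expectation of F when every subset of [n] is selected
-- independently with probability u / (u + v).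
module Random (u v : ℕ) where

  w : ℕ
  w = u + v

  -- This is `w` to the power 2^n, one factor for each subset of [n]. Without normalisation all
  -- expectations stay natural numbers.
  weight : ℕ → ℕ
  weight zero    = w
  weight (suc n) = weight n * weight n

  𝔼 : ∀ n → ((Subset n → Bool) → ℕ) → ℕ
  𝔼 zero    F = u * F (λ _ → true) + v * F (λ _ → false)
  𝔼 (suc n) F = 𝔼 n (λ f → 𝔼 n (λ g → F (combine f g)))

  weight-nonZero : .{{NonZero w}} → ∀ n → NonZero (weight n)
  weight-nonZero zero    = >-nonZero (>-nonZero⁻¹ w)
  weight-nonZero (suc n) = m*n≢0 (weight n) (weight n) {{weight-nonZero n}} {{weight-nonZero n}}

  𝔼-cong : ∀ n {F G} → (∀ c → F c ≡ G c) → 𝔼 n F ≡ 𝔼 n G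
  𝔼-cong zero    F≡G = cong₂ (λ x y → u * x + v * y) (F≡G _) (F≡G _)
  𝔼-cong (suc n) F≡G = 𝔼-cong n λ f → 𝔼-cong n λ g → F≡G _

  𝔼-const : ∀ n k → 𝔼 n (λ _ → k) ≡ k * weight n
  𝔼-* : ∀ n k F → 𝔼 n (λ c → k * F c) ≡ k * 𝔼 n F

  𝔼-const zero k = poly u v k
    where
    poly : ∀ u v k → u * k + v * k ≡ k * (u + v)
    poly = solve-∀
  𝔼-const (suc n) k = begin
    𝔼 n (λ _ → 𝔼 n (λ _ → k))  ≡⟨ 𝔼-cong n (λ _ → 𝔼-const n k) ⟩
    𝔼 n (λ _ → k * weight n)    ≡⟨ 𝔼-const n _ ⟩
    k * weight n * weight n     ≡⟨ *-assoc k _ _ ⟩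
    k * (weight n * weight n)   ∎
    where open ≡-Reasoning

  𝔼-* zero k F = poly u v k (F _) (F _)
    where
    poly : ∀ u v k x y → u * (k * x) + v * (k * y) ≡ k * (u * x + v * y)
    poly = solve-∀
  𝔼-* (suc n) k F = trans (𝔼-cong n λ f → 𝔼-* n k _) (𝔼-* n k _)

  𝔼-+ : ∀ n F G → 𝔼 n (λ c → F c + G c) ≡ 𝔼 n F + 𝔼 n G
  𝔼-+ zero F G = poly u v (F _) (G _) (F _) (G _)
    where
    poly : ∀ u v a b x y → u * (a + b) + v * (x + y) ≡ (u * a + v * x) + (u * b + v * y)
    poly = solve-∀
  𝔼-+ (suc n) F G = trans (𝔼-cong n λ f → 𝔼-+ n _ _) (𝔼-+ n _ _)

  𝔼-∑ : ∀ n {A : Set} (F : A → (Subset n → Bool) → ℕ) xs → 𝔼 n (λ c → ∑ (λ x → F x c) xs) ≡ ∑ (λ x → 𝔼 n (F x)) xs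
  𝔼-∑ n F []       = 𝔼-const n 0
  𝔼-∑ n F (x ∷ xs) = trans (𝔼-+ n (F x) _) (cong (𝔼 n (F x) +_) (𝔼-∑ n F xs))

  -- Method of conditional expectations: first the half `f` is fixed without raising the mean, then
  -- the half `g`. At the bottom the smaller of two values is taken.
  ∃≤𝔼 : ∀ n F → ∃ λ c → weight n * F c ≤ 𝔼 n F
  ∃≤𝔼 zero F with ≤-total (F λ _ → true) (F λ _ → false)
  ... | inj₁ t≤f = (λ _ → true) , ≤-trans (≤-reflexive (*-distribʳ-+ _ u v)) (+-monoʳ-≤ (u * F _) (*-monoʳ-≤ v t≤f))
  ... | inj₂ f≤t = (λ _ → false) , ≤-trans (≤-reflexive (*-distribʳ-+ _ u v)) (+-monoˡ-≤ (v * F _) (*-monoʳ-≤ u f≤t))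
  ∃≤𝔼 (suc n) F =
    let f , f≤ = ∃≤𝔼 n (λ f → 𝔼 n (λ g → F (combine f g)))
        g , g≤ = ∃≤𝔼 n (λ g → F (combine f g))
    in combine f g , ≤-trans (≤-trans (≤-reflexive (*-assoc (weight n) _ _)) (*-monoʳ-≤ (weight n) g≤)) f≤

  -- The selection of `X` is one Bernoulli trial, and the trials for all other sets integrate out.
  -- The factor `w` on the left replaces a division of `weight n` by `w`.
  𝔼-at : ∀ {n} (φ : Bool → ℕ) (X : Subset n) →
         w * 𝔼 n (λ c → φ (c X)) ≡ (u * φ true + v * φ false) * weight n
  𝔼-at φ [] = *-comm w _
  𝔼-at {suc n} φ (true ∷ X) = begin
    w * 𝔼 n (λ f → 𝔼 n (λ _ → φ (f X)))  ≡⟨ cong (w *_) (𝔼-cong n λ f → trans (𝔼-const n _) (*-comm (φ (f X)) _)) ⟩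
    w * 𝔼 n (λ f → weight n * φ (f X))    ≡⟨ cong (w *_) (𝔼-* n (weight n) _) ⟩
    w * (weight n * 𝔼 n (λ f → φ (f X)))  ≡⟨ poly w (weight n) _ ⟩
    w * 𝔼 n (λ f → φ (f X)) * weight n    ≡⟨ cong (_* weight n) (𝔼-at φ X) ⟩
    k * weight n * weight n               ≡⟨ *-assoc k _ _ ⟩
    k * (weight n * weight n)             ∎
    where
    open ≡-Reasoning
    k = u * φ true + v * φ false
    poly : ∀ a b c → a * (b * c) ≡ a * c * b
    poly = solve-∀
  𝔼-at {suc n} φ (false ∷ X) = begin
    w * 𝔼 n (λ _ → 𝔼 n (λ g → φ (g X)))   ≡⟨ cong (w *_) (𝔼-const n _) ⟩
    w * (𝔼 n (λ g → φ (g X)) * weight n)   ≡⟨ *-assoc w _ _ ⟨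
    w * 𝔼 n (λ g → φ (g X)) * weight n     ≡⟨ cong (_* weight n) (𝔼-at φ X) ⟩
    k * weight n * weight n                ≡⟨ *-assoc k _ _ ⟩
    k * (weight n * weight n)              ∎
    where
    open ≡-Reasoning
    k = u * φ true + v * φ false

-- Tests that no set obtained from X by deleting one element belongs to c.
isolated : ∀ {n} → Subset n → (Subset n → Bool) → Bool
isolated []          c = true
isolated (true  ∷ X) c = not (c (outside ∷ X)) ∧ isolated X (c ∘ (inside ∷_))
isolated (false ∷ X) c = isolated X (c ∘ (outside ∷_))

module _ (u v : ℕ) where
  open Random u v

  -- The deletions of single points from `X` are distinct sets, so their trials are independent.
  -- Deleting the first point gives a set governed by `g`; all other deletions keep it and are
  -- governed by `f`, so the expectation factors.
  𝔼-isolated : ∀ {n} (X : Subset n) → w ^ ∣ X ∣ * 𝔼 n (ι ∘ isolated X) ≡ v ^ ∣ X ∣ * weight n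
  𝔼-isolated [] = cong (1 *_) (trans (𝔼-const 0 1) (*-identityˡ w))
  𝔼-isolated {suc n} (true ∷ X) = begin
    w * w ^ ∣ X ∣ * 𝔼 n (λ f → 𝔼 n (λ g → ι (not (g X) ∧ isolated X f)))
      ≡⟨ cong (w * w ^ ∣ X ∣ *_) (𝔼-cong n λ f → trans
           (𝔼-cong n λ g → trans (ι-∧ (not (g X)) _) (*-comm (ι (not (g X))) _))
           (trans (𝔼-* n (ι (isolated X f)) _) (*-comm (ι (isolated X f)) avoid))) ⟩
    w * w ^ ∣ X ∣ * 𝔼 n (λ f → avoid * ι (isolated X f))
      ≡⟨ cong (w * w ^ ∣ X ∣ *_) (𝔼-* n avoid _) ⟩
    w * w ^ ∣ X ∣ * (avoid * 𝔼 n (ι ∘ isolated X))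
      ≡⟨ interchange w (w ^ ∣ X ∣) _ _ ⟩
    (w * avoid) * (w ^ ∣ X ∣ * 𝔼 n (ι ∘ isolated X))
      ≡⟨ cong₂ _*_ (𝔼-at (ι ∘ not) X) (𝔼-isolated X) ⟩
    (u * 0 + v * 1) * weight n * (v ^ ∣ X ∣ * weight n)
      ≡⟨ poly u v (weight n) (v ^ ∣ X ∣) ⟩
    v * v ^ ∣ X ∣ * (weight n * weight n) ∎
    where
    open ≡-Reasoning
    avoid = 𝔼 n (λ g → ι (not (g X)))
    interchange : ∀ a b c d → a * b * (c * d) ≡ (a * c) * (b * d)
    interchange = solve-∀
    poly : ∀ u v a b → (u * 0 + v * 1) * a * (b * a) ≡ v * b * (a * a)
    poly = solve-∀
  𝔼-isolated {suc n} (false ∷ X) = begin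
    w ^ ∣ X ∣ * 𝔼 n (λ _ → 𝔼 n (ι ∘ isolated X))  ≡⟨ cong (w ^ ∣ X ∣ *_) (𝔼-const n _) ⟩
    w ^ ∣ X ∣ * (𝔼 n (ι ∘ isolated X) * weight n)  ≡⟨ *-assoc (w ^ ∣ X ∣) _ _ ⟨
    w ^ ∣ X ∣ * 𝔼 n (ι ∘ isolated X) * weight n    ≡⟨ cong (_* weight n) (𝔼-isolated X) ⟩
    v ^ ∣ X ∣ * weight n * weight n                ≡⟨ *-assoc (v ^ ∣ X ∣) _ _ ⟩
    v ^ ∣ X ∣ * (weight n * weight n)              ∎
    where open ≡-Reasoning

-- The recursive construction

prefix : ∀ {n} → ℕ → Subset n → Subset n
prefix zero    X           = ⊥
prefix (suc j) []          = []
prefix (suc j) (true  ∷ X) = inside ∷ prefix j X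
prefix (suc j) (false ∷ X) = outside ∷ prefix (suc j) X

∣prefix∣ : ∀ {n} j (X : Subset n) → j ≤ ∣ X ∣ → ∣ prefix j X ∣ ≡ j
∣prefix∣ {n} zero X _                 = ∣⊥∣≡0 n
∣prefix∣ (suc j) (true  ∷ X) (s≤s j≤) = cong suc (∣prefix∣ j X j≤)
∣prefix∣ (suc j) (false ∷ X) j≤       = ∣prefix∣ (suc j) X j≤

isolated-⊥ : ∀ n (c : Subset n → Bool) → isolated ⊥ c ≡ true
isolated-⊥ zero    c = refl
isolated-⊥ (suc n) c = isolated-⊥ n _

-- Some selected set arises from the first `j` points of `Y` by deleting a point x. Then `Y` without
-- x has this selected set as its first j-1 points.
¬isolated⇒∃ : ∀ {n} j (Y : Subset n) c → isolated (prefix j Y) c ≡ false →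
              ∃ λ e → e ⊆ Y × suc ∣ e ∣ ≡ ∣ Y ∣ × T (c (prefix (pred j) e))
¬isolated⇒∃ {n} zero Y c eq with () ← trans (sym (isolated-⊥ n c)) eq
¬isolated⇒∃ (suc j) (true ∷ Y) c eq with c (outside ∷ prefix j Y) in hit
... | true = outside ∷ Y , out⊆ ⊆-refl , refl , subst T (sym (trans (cong c (prefix-outside j)) hit)) tt
  where
  prefix-outside : ∀ j → prefix j (outside ∷ Y) ≡ outside ∷ prefix j Y
  prefix-outside zero    = refl
  prefix-outside (suc j) = refl
... | false = go j eq
  where
  go : ∀ j → isolated (prefix j Y) (c ∘ (inside ∷_)) ≡ false →
       ∃ λ e → e ⊆ (true ∷ Y) × suc ∣ e ∣ ≡ suc ∣ Y ∣ × T (c (prefix j e))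
  -- Only one point was up for deletion, and that deletion has already been found unselected.
  go zero eq with () ← trans (sym (isolated-⊥ _ (c ∘ (inside ∷_)))) eq
  go (suc j) eq =
    let e , e⊆Y , size , e∈ = ¬isolated⇒∃ (suc j) Y _ eq
    in inside ∷ e , s⊆s e⊆Y , cong suc size , e∈
¬isolated⇒∃ (suc j) (false ∷ Y) c eq =
  let e , e⊆Y , size , e∈ = ¬isolated⇒∃ (suc j) Y (c ∘ (outside ∷_)) eq
  in outside ∷ e , s⊆s e⊆Y , size , subst (T ∘ c) (sym (prefix-outside j e)) e∈
  where
  prefix-outside : ∀ j e → prefix j (outside ∷ e) ≡ outside ∷ prefix j e
  prefix-outside zero    e = refl
  prefix-outside (suc j) e = refl

module _ (g : ∀ n → Subset n → Bool) where

  -- Applies g to the part of X after its j-th element, a subset of the points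
  -- that follow that element.
  suffix∈ : ∀ {n} → ℕ → Subset n → Bool
  suffix∈ {n} zero X          = g n X
  suffix∈ (suc j) []          = false
  suffix∈ (suc j) (true  ∷ X) = suffix∈ j X
  suffix∈ (suc j) (false ∷ X) = suffix∈ (suc j) X

  -- The point dropped from `Y` lies after the first `j`, so the prefix is unchanged and its
  -- isolation passes from `Y` to the edge.
  suffix∈-cover : ∀ s → (∀ n (Y : Subset n) → ∣ Y ∣ ≡ s → ∃ λ e → e ⊆ Y × suc ∣ e ∣ ≡ ∣ Y ∣ × T (g n e)) →
                  ∀ {n} j (Y : Subset n) → ∣ Y ∣ ≡ j + s →
                  ∃ λ e → e ⊆ Y × suc ∣ e ∣ ≡ ∣ Y ∣ × prefix j e ≡ prefix j Y × T (suffix∈ j e)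
  suffix∈-cover s cover {n} zero Y size =
    let e , e⊆Y , size′ , e∈ = cover n Y size in e , e⊆Y , size′ , refl , e∈
  suffix∈-cover s cover (suc j) (true ∷ Y) size =
    let e , e⊆Y , size′ , eq , e∈ = suffix∈-cover s cover j Y (suc-injective size)
    in inside ∷ e , s⊆s e⊆Y , cong suc size′ , cong (inside ∷_) eq , e∈
  suffix∈-cover s cover (suc j) (false ∷ Y) size =
    let e , e⊆Y , size′ , eq , e∈ = suffix∈-cover s cover (suc j) Y size
    in outside ∷ e , s⊆s e⊆Y , size′ , cong (outside ∷_) eq , e∈

  -- For each position of the j-th element the suffix ranges over all q-subsets of the later points,
  -- where `g` has density at most a/b; an average of such densities is at most a/b. The induction
  -- splits on the first point, by Pascal's rule.
  suffix∈-count : ∀ q a b → (∀ n → ∑ (ι ∘ g n) (subsets n q) * b ≤ a * (n C q)) →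
                  ∀ j n → ∑ (ι ∘ suffix∈ j) (subsets n (j + q)) * b ≤ a * (n C (j + q))
  suffix∈-count q a b bound zero    n       = bound n
  suffix∈-count q a b bound (suc j) zero    = z≤n
  suffix∈-count q a b bound (suc j) (suc n) = begin
    ∑ (ι ∘ suffix∈ (suc j)) (subsets (suc n) (suc r)) * b
      ≡⟨ cong (_* b) (∑-subsets n r (ι ∘ suffix∈ (suc j))) ⟩
    (∑ (ι ∘ suffix∈ j) (subsets n r) + ∑ (ι ∘ suffix∈ (suc j)) (subsets n (suc r))) * b
      ≡⟨ *-distribʳ-+ b (∑ (ι ∘ suffix∈ j) (subsets n r)) _ ⟩
    ∑ (ι ∘ suffix∈ j) (subsets n r) * b + ∑ (ι ∘ suffix∈ (suc j)) (subsets n (suc r)) * b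
      ≤⟨ +-mono-≤ (suffix∈-count q a b bound j n) (suffix∈-count q a b bound (suc j) n) ⟩
    a * (n C r) + a * (n C suc r)
      ≡⟨ *-distribˡ-+ a (n C r) _ ⟨
    a * (n C r + n C suc r)
      ≡⟨ cong (a *_) (nCk+nC[k+1]≡[n+1]C[k+1] n r) ⟩
    a * (suc n C suc r) ∎
    where
    open ≤-Reasoning
    r = j + q

-- Upper bounds on D(s) and the recursion inequality

-- D(s) ≤ a/b, the systems being given by their indicator functions; junk for s = 0.
record Density≤ (s a b : ℕ) : Set where
  constructor mk
  field
    system : ∀ n → ∃ λ (g : Subset n → Bool) →
      (∀ Y → ∣ Y ∣ ≡ s → ∃ λ e → e ⊆ Y × suc ∣ e ∣ ≡ ∣ Y ∣ × T (g e)) ×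
      ∑ (ι ∘ g) (subsets n (pred s)) * b ≤ a * (n C pred s)
open Density≤

toTuran : ∀ {s a b} → Density≤ (suc s) a b → ∀ n → TuranLeFrac n (suc s) s (a * (n C s)) b
toTuran {s} {a} {b} D n with g , cover , count ← system D n =
  filter (T? ∘ g) (subsets n s) ,
  ((Uniqueₚ.filter⁺ (T? ∘ g) (subsets-unique n s) , Allₚ.filter⁺ (T? ∘ g) (subsets-size n s)) ,
   λ X size → let e , e⊆X , size′ , e∈ = cover X size in
     lose (∈-filter⁺ (T? ∘ g) (subst (λ r → e ∈ subsets n r) (suc-injective (trans size′ size)) (∈-subsets e)) e∈) e⊆X) ,
  subst (λ k → k * b ≤ a * (n C s)) (sym (length-filter-T g (subsets n s))) count

weaken : ∀ {s a b a′ b′} .{{_ : NonZero b}} → a * b′ ≤ a′ * b → Density≤ s a b → Density≤ s a′ b′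
weaken {s} {a} {b} {a′} {b′} ab′≤a′b D .system n with g , cover , count ← system D n =
  g , cover , *-cancelʳ-≤ _ _ b (begin
    N * b′ * b    ≡⟨ swap N b′ b ⟩
    N * b * b′    ≤⟨ *-monoˡ-≤ b′ count ⟩
    a * K * b′    ≡⟨ swap a K b′ ⟩
    a * b′ * K    ≤⟨ *-monoˡ-≤ K ab′≤a′b ⟩
    a′ * b * K    ≡⟨ swap a′ b K ⟩
    a′ * K * b    ∎)
  where
  open ≤-Reasoning
  N = ∑ (ι ∘ g) (subsets n (pred s))
  K = n C pred s
  swap : ∀ x y z → x * y * z ≡ x * z * y
  swap = solve-∀


module _ (u v : ℕ) {e f : ℕ} .{{_ : NonZero (u + v)}} where
  open Random u v

  private
    𝔼-isolated-≤ : ∀ {n} (X : Subset n) → v ^ ∣ X ∣ * f ≤ e * w ^ ∣ X ∣ →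
                   f * 𝔼 n (ι ∘ isolated X) ≤ e * weight n
    𝔼-isolated-≤ {n} X vf≤ew = *-cancelˡ-≤ (w ^ ∣ X ∣) {{m^n≢0 w ∣ X ∣}} (begin
      w ^ ∣ X ∣ * (f * P)          ≡⟨ swap (w ^ ∣ X ∣) f P ⟩
      f * (w ^ ∣ X ∣ * P)          ≡⟨ cong (f *_) (𝔼-isolated u v X) ⟩
      f * (v ^ ∣ X ∣ * weight n)   ≡⟨ rotate f (v ^ ∣ X ∣) (weight n) ⟩
      v ^ ∣ X ∣ * f * weight n     ≤⟨ *-monoˡ-≤ (weight n) vf≤ew ⟩
      e * w ^ ∣ X ∣ * weight n     ≡⟨ rotate (w ^ ∣ X ∣) e (weight n) ⟨
      w ^ ∣ X ∣ * (e * weight n)   ∎)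
      where
      open ≤-Reasoning
      P = 𝔼 n (ι ∘ isolated X)
      swap : ∀ x y z → x * (y * z) ≡ y * (x * z)
      swap = solve-∀
      rotate : ∀ x y z → x * (y * z) ≡ y * x * z
      rotate = solve-∀

  -- p = u / (u + v), and e / f is an upper bound for (1-p)^j.
  density-step : ∀ {q a b} j → v ^ j * f ≤ e * (u + v) ^ j → Density≤ (suc q) a b →
                 Density≤ (j + suc q) (u * f * b + e * a * (u + v)) ((u + v) * f * b)
  density-step {q} {a} {b} j vf≤ew D .system n = edge c , cover , count
    where
    g : ∀ n → Subset n → Bool
    g n = proj₁ (system D n)

    edge : (Subset n → Bool) → Subset n → Bool
    edge c X = c (prefix (pred j) X) ∨ (isolated (prefix j X) c ∧ suffix∈ g j X)

    h : Subset n → ℕ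
    h = ι ∘ suffix∈ g j

    term : Subset n → (Subset n → Bool) → ℕ
    term X c = ι (c (prefix (pred j) X)) + ι (isolated (prefix j X) c) * h X

    edge≤term : ∀ c X → ι (edge c X) ≤ term X c
    edge≤term c X = ≤-trans (ι-∨ (c (prefix (pred j) X)) _)
      (+-monoʳ-≤ (ι (c (prefix (pred j) X))) (≤-reflexive (ι-∧ (isolated (prefix j X) c) (suffix∈ g j X))))

    L : List (Subset n)
    L = subsets n (j + q)

    W : ℕ
    W = weight n

    𝔼-term : ∀ X → ∣ X ∣ ≡ j + q → w * f * 𝔼 n (term X) ≤ f * u * W + w * e * W * h X
    𝔼-term X size = begin
      w * f * 𝔼 n (term X)
        ≡⟨ cong (w * f *_) (trans (𝔼-+ n _ _) (cong (A +_) (trans (𝔼-cong n λ c → *-comm _ (h X)) (𝔼-* n (h X) _)))) ⟩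
      w * f * (A + h X * B)
        ≡⟨ poly w f A (h X) B ⟩
      f * (w * A) + w * h X * (f * B)
        -- The shorter prefix is selected with probability u/w. The longer one has exactly `j`
        -- elements, so it is isolated with probability at most e/f.
        ≤⟨ +-mono-≤ (≤-reflexive (cong (f *_) (𝔼-at ι (prefix (pred j) X))))
                    (*-monoʳ-≤ (w * h X) (𝔼-isolated-≤ (prefix j X)
                      (subst (λ i → v ^ i * f ≤ e * w ^ i) (sym ∣pre∣) vf≤ew))) ⟩
      f * ((u * 1 + v * 0) * W) + w * h X * (e * W)
        ≡⟨ poly′ f u v W w (h X) e ⟩
      f * u * W + w * e * W * h X ∎
      where
      open ≤-Reasoning
      A = 𝔼 n (λ c → ι (c (prefix (pred j) X)))
      B = 𝔼 n (ι ∘ isolated (prefix j X))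
      ∣pre∣ : ∣ prefix j X ∣ ≡ j
      ∣pre∣ = ∣prefix∣ j X (≤-trans (m≤m+n j q) (≤-reflexive (sym size)))
      poly : ∀ w f a h b → w * f * (a + h * b) ≡ f * (w * a) + w * h * (f * b)
      poly = solve-∀
      poly′ : ∀ f u v W w h e → f * ((u * 1 + v * 0) * W) + w * h * (e * W) ≡ f * u * W + w * e * W * h
      poly′ = solve-∀

    -- Averaging is needed for the edge count only: `cover` below holds for any choice of the
    -- family.
    chosen : ∃ λ c → W * ∑ (λ X → term X c) L ≤ 𝔼 n (λ c → ∑ (λ X → term X c) L)
    chosen = ∃≤𝔼 n (λ c → ∑ (λ X → term X c) L)

    c : Subset n → Bool
    c = proj₁ chosen

    cover : ∀ Y → ∣ Y ∣ ≡ j + suc q → ∃ λ X → X ⊆ Y × suc ∣ X ∣ ≡ ∣ Y ∣ × T (edge c X)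
    cover Y size with isolated (prefix j Y) c in iso
    ... | false =
      let X , X⊆Y , size′ , X∈ = ¬isolated⇒∃ j Y c iso
      in X , X⊆Y , size′ , Equivalence.from T-∨ (inj₁ X∈)
    ... | true =
      let X , X⊆Y , size′ , pre≡ , X∈ = suffix∈-cover g (suc q) (λ n → proj₁ (proj₂ (system D n))) j Y size
      in X , X⊆Y , size′ , Equivalence.from T-∨ (inj₂ (Equivalence.from T-∧
           (subst T (sym (trans (cong (λ Z → isolated Z c) pre≡) iso)) tt , X∈)))

    binom : ℕ
    binom = n C (j + q)

    scaled : W * (∑ (ι ∘ edge c) L * (w * f * b)) ≤ W * ((u * f * b + e * a * w) * binom)
    scaled = begin
      W * (∑ (ι ∘ edge c) L * (w * f * b))
        ≡⟨ poly₁ W (∑ (ι ∘ edge c) L) (w * f) b ⟩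
      w * f * (W * ∑ (ι ∘ edge c) L) * b
        ≤⟨ *-monoˡ-≤ b (*-monoʳ-≤ (w * f) (*-monoʳ-≤ W (∑-mono (All.universal (edge≤term c) L)))) ⟩
      w * f * (W * ∑ (λ X → term X c) L) * b
        ≤⟨ *-monoˡ-≤ b (*-monoʳ-≤ (w * f) (proj₂ chosen)) ⟩
      w * f * 𝔼 n (λ c → ∑ (λ X → term X c) L) * b
        ≡⟨ cong (λ x → w * f * x * b) (𝔼-∑ n term L) ⟩
      w * f * ∑ (λ X → 𝔼 n (term X)) L * b
        ≡⟨ cong (_* b) (∑-affine 0 (w * f) (λ X → 𝔼 n (term X)) L) ⟨
      ∑ (λ X → w * f * 𝔼 n (term X)) L * b
        ≤⟨ *-monoˡ-≤ b (∑-mono (All.map (𝔼-term _) (subsets-size n (j + q)))) ⟩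
      ∑ (λ X → f * u * W + w * e * W * h X) L * b
        ≡⟨ cong (_* b) (∑-affine (f * u * W) (w * e * W) h L) ⟩
      (f * u * W * length L + w * e * W * ∑ h L) * b
        ≡⟨ poly₂ (f * u * W * length L) (w * e * W) (∑ h L) b ⟩
      f * u * W * length L * b + w * e * W * (∑ h L * b)
        ≤⟨ +-mono-≤ (≤-reflexive (cong (λ x → f * u * W * x * b) (length-subsets n (j + q))))
                    (*-monoʳ-≤ (w * e * W) (suffix∈-count g q a b (λ n → proj₂ (proj₂ (system D n))) j n)) ⟩
      f * u * W * binom * b + w * e * W * (a * binom)
        ≡⟨ poly₃ f u W binom b w e a ⟩
      W * ((u * f * b + e * a * w) * binom) ∎
      where
      open ≤-Reasoning
      poly₁ : ∀ W s x b → W * (s * (x * b)) ≡ x * (W * s) * b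
      poly₁ = solve-∀
      poly₂ : ∀ x y z b → (x + y * z) * b ≡ x * b + y * (z * b)
      poly₂ = solve-∀
      poly₃ : ∀ f u W k b w e a → f * u * W * k * b + w * e * W * (a * k) ≡ W * ((u * f * b + e * a * w) * k)
      poly₃ = solve-∀

    count : ∑ (ι ∘ edge c) (subsets n (pred (j + suc q))) * (w * f * b) ≤ (u * f * b + e * a * w) * (n C pred (j + suc q))
    count = subst (λ r → ∑ (ι ∘ edge c) (subsets n r) * (w * f * b) ≤ (u * f * b + e * a * w) * (n C r))
                  (sym (cong pred (+-suc j q)))
                  (*-cancelˡ-≤ W {{weight-nonZero n}} scaled)

-- Base case and special cases of the recursion

-- The empty set is the only 0-subset and lies in every singleton.
density-one : Density≤ 1 1 1
density-one .system n = (λ _ → true) , (λ Y size → ⊥ , ⊥⊆ , trans (cong suc (∣⊥∣≡0 n)) (sym size) , tt) , count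
  where
  open ≤-Reasoning
  count : ∑ (λ _ → 1) (subsets n 0) * 1 ≤ 1 * (n C 0)
  count = begin
    ∑ (λ _ → 1) (subsets n 0) * 1   ≡⟨ *-identityʳ _ ⟩
    ∑ (λ _ → 1) (subsets n 0)       ≡⟨ ∑-affine 1 0 (λ _ → 0) (subsets n 0) ⟩
    1 * _ + 0                       ≡⟨ +-identityʳ _ ⟩
    1 * _                           ≡⟨ cong (1 *_) (length-subsets n 0) ⟩
    1 * (n C 0)                     ∎

-- This is the recursion with p = 0 and e/f = 1.
density-mono : ∀ {s s′ a b} .{{_ : NonZero s}} → s ≤ s′ → Density≤ s a b → Density≤ s′ a b
density-mono {suc q} {s′} {a} {b} s≤s′ D =
  subst (λ i → Density≤ i a b) (m∸n+n≡m s≤s′)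
    (subst₂ (Density≤ _) (poly a) (poly′ b)
      (density-step 0 1 {1} {1} (s′ ∸ suc q) (≤-reflexive (*-comm _ 1)) D))
  where
  poly : ∀ a → 1 * a * 1 ≡ a
  poly = solve-∀
  poly′ : ∀ b → 1 * b ≡ b
  poly′ = solve-∀

-- For p = 1/s and D(s) ≤ (a/b)/s both terms of the recursion carry a factor 1/s, and the bound
-- becomes (1 + (e/f)(a/b))/s.
density-step-1/s : ∀ {v a b e f} j .{{_ : NonZero f}} .{{_ : NonZero b}} → v ^ j * f ≤ e * suc v ^ j →
                   Density≤ (suc v) a (b * suc v) →
                   Density≤ (j + suc v) (f * b + e * a) (f * b * suc v)
density-step-1/s {v} {a} {b} {e} {f} j vf≤ew D =
  weaken {{m*n≢0 (suc v * f) (b * suc v) {{m*n≢0 (suc v) f}} {{m*n≢0 b (suc v)}}}}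
    (≤-reflexive (poly f b (suc v) e a)) (density-step 1 v {e} {f} j vf≤ew D)
  where
  poly : ∀ f b w e a → (1 * f * (b * w) + e * a * w) * (f * b * w) ≡ (f * b + e * a) * (w * f * (b * w))
  poly = solve-∀

-- Estimates for powers of 1 - 1/w, and rounding

-- (1 - 1/w)^t ≤ 1 - t/w + t²/(2w²) for w = suc v, without subtraction.
bernoulli₂ : ∀ v t → let w = suc v in
             2 * w * w * v ^ t + 2 * t * w * w ^ t ≤ (2 * w * w + t * t) * w ^ t
bernoulli₂ v zero    = ≤-reflexive (poly v)
  where
  poly : ∀ v → let w = suc v in 2 * w * w * 1 + 0 * w * 1 ≡ (2 * w * w + 0) * 1
  poly = solve-∀
-- The added term is `v` times the second term on the left of the induction hypothesis, which can
-- then be multiplied by `v` as a whole.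
bernoulli₂ v (suc t) = +-cancelʳ-≤ (2 * t * w * v * w ^ t) _ _ (begin
  2 * w * w * (v * V) + 2 * suc t * w * (w * W) + 2 * t * w * v * W
    ≡⟨ poly₁ v t V W ⟩
  v * (2 * w * w * V + 2 * t * w * W) + 2 * suc t * w * w * W
    ≤⟨ +-monoˡ-≤ (2 * suc t * w * w * W) (*-monoʳ-≤ v (bernoulli₂ v t)) ⟩
  v * ((2 * w * w + t * t) * W) + 2 * suc t * w * w * W
    ≤⟨ m≤m+n _ ((t * t + w) * W) ⟩
  v * ((2 * w * w + t * t) * W) + 2 * suc t * w * w * W + (t * t + w) * W
    ≡⟨ poly₂ v t W ⟩
  (2 * w * w + suc t * suc t) * (w * W) + 2 * t * w * v * W ∎)
  where
  open ≤-Reasoning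
  w = suc v
  V = v ^ t
  W = w ^ t
  poly₁ : ∀ v t V W → let w = suc v in
          2 * w * w * (v * V) + 2 * suc t * w * (w * W) + 2 * t * w * v * W ≡
          v * (2 * w * w * V + 2 * t * w * W) + 2 * suc t * w * w * W
  poly₁ = solve-∀
  poly₂ : ∀ v t W → let w = suc v in
          v * ((2 * w * w + t * t) * W) + 2 * suc t * w * w * W + (t * t + w) * W ≡
          (2 * w * w + suc t * suc t) * (w * W) + 2 * t * w * v * W
  poly₂ = solve-∀

^-distribʳ-* : ∀ x y m → (x * y) ^ m ≡ x ^ m * y ^ m
^-distribʳ-* x y zero    = refl
^-distribʳ-* x y (suc m) = trans (cong (x * y *_) (^-distribʳ-* x y m)) (poly x y (x ^ m) (y ^ m))
  where
  poly : ∀ a b c d → a * b * (c * d) ≡ a * c * (b * d)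
  poly = solve-∀

s≤κt+κ : ∀ s κ .{{_ : NonZero κ}} → s ≤ κ * (s / κ) + pred κ
s≤κt+κ s κ = begin
  s                     ≡⟨ m≡m%n+[m/n]*n s κ ⟩
  s % κ + s / κ * κ     ≤⟨ +-monoˡ-≤ (s / κ * κ) (<⇒≤pred (m%n<n s κ)) ⟩
  pred κ + s / κ * κ    ≡⟨ +-comm (pred κ) _ ⟩
  s / κ * κ + pred κ    ≡⟨ cong (_+ pred κ) (*-comm (s / κ) κ) ⟩
  κ * (s / κ) + pred κ  ∎
  where open ≤-Reasoning

κt≤s : ∀ s κ .{{_ : NonZero κ}} → κ * (s / κ) ≤ s
κt≤s s κ = ≤-trans (≤-reflexive (*-comm κ (s / κ))) (m/n*n≤m s κ)

-- As s is at most (q/p) t, an inequality in the variables `s` and `t` is reduced to one that may be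
-- purely numerical.
*-linear-≤ : ∀ {p q x y s t} .{{_ : NonZero p}} → p * s ≤ q * t → x * q ≤ y * p → x * s ≤ y * t
*-linear-≤ {p} {q} {x} {y} {s} {t} ps≤qt xq≤yp = *-cancelˡ-≤ p (begin
  p * (x * s)  ≡⟨ poly p x s ⟩
  x * (p * s)  ≤⟨ *-monoʳ-≤ x ps≤qt ⟩
  x * (q * t)  ≡⟨ *-assoc x q t ⟨
  x * q * t    ≤⟨ *-monoˡ-≤ t xq≤yp ⟩
  y * p * t    ≡⟨ cong (_* t) (*-comm y p) ⟩
  p * y * t    ≡⟨ *-assoc p y t ⟩
  p * (y * t)  ∎)
  where
  open ≤-Reasoning
  poly : ∀ p x s → p * (x * s) ≡ x * (p * s)
  poly = solve-∀

-- Iterating the recursion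

Eventually≤ : (a b : ℕ) → Set
Eventually≤ a b = ∃ λ N → ∀ s → N ≤ s → Density≤ s a (b * s)

-- The recursion for s = l t, j = m t and p = 1/s.  As K / (2l²) = 1 - 1/l + 1/(2l²),
-- bernoulli₂ gives (1-p)^j ≤ (K / (2l²))^m ≤ e / f uniformly in t.
module Ladder (l m K e f : ℕ) .{{_ : NonZero l}} .{{_ : NonZero f}}
              (K≡ : K + 2 * l ≡ 2 * l * l + 1) (K^m≤ : K ^ m * f ≤ e * (2 * l * l) ^ m) where

  private
    instance
      2ll≢0 : NonZero (2 * l * l)
      2ll≢0 = m*n≢0 (2 * l) l {{m*n≢0 2 l}}

  -- In `bernoulli₂` with w = l t the ratio t/w is 1/l, so a factor t² cancels and the bound no
  -- longer depends on t.
  power-t : ∀ v t .{{_ : NonZero t}} → suc v ≡ l * t → 2 * l * l * v ^ t ≤ K * suc v ^ t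
  power-t v t w≡ = +-cancelʳ-≤ (2 * l * W) _ _ (*-cancelˡ-≤ (t * t) {{m*n≢0 t t}} (begin
    t * t * (2 * l * l * v ^ t + 2 * l * W)
      ≡⟨ poly₁ l t (v ^ t) W ⟩
    2 * (l * t) * (l * t) * v ^ t + 2 * t * (l * t) * W
      ≡⟨ cong (λ w → 2 * w * w * v ^ t + 2 * t * w * W) w≡ ⟨
    2 * suc v * suc v * v ^ t + 2 * t * suc v * W
      ≤⟨ bernoulli₂ v t ⟩
    (2 * suc v * suc v + t * t) * W
      ≡⟨ cong (λ w → (2 * w * w + t * t) * W) w≡ ⟩
    (2 * (l * t) * (l * t) + t * t) * W
      ≡⟨ poly₂ l t W ⟩
    t * t * ((2 * l * l + 1) * W)
      ≡⟨ cong (λ k → t * t * (k * W)) K≡ ⟨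
    t * t * ((K + 2 * l) * W)
      ≡⟨ cong (t * t *_) (*-distribʳ-+ W K (2 * l)) ⟩
    t * t * (K * W + 2 * l * W) ∎))
    where
    open ≤-Reasoning
    W = suc v ^ t
    poly₁ : ∀ l t V W → t * t * (2 * l * l * V + 2 * l * W) ≡ 2 * (l * t) * (l * t) * V + 2 * t * (l * t) * W
    poly₁ = solve-∀
    poly₂ : ∀ l t W → (2 * (l * t) * (l * t) + t * t) * W ≡ t * t * ((2 * l * l + 1) * W)
    poly₂ = solve-∀

  power-mt : ∀ v t .{{_ : NonZero t}} → suc v ≡ l * t → v ^ (m * t) * f ≤ e * suc v ^ (m * t)
  power-mt v t w≡ rewrite *-comm m t | sym (^-*-assoc v t m) | sym (^-*-assoc (suc v) t m) =
    *-cancelˡ-≤ ((2 * l * l) ^ m) {{m^n≢0 (2 * l * l) m}} (begin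
      B * (V ^ m * f)            ≡⟨ *-assoc B (V ^ m) f ⟨
      B * V ^ m * f              ≡⟨ cong (_* f) (^-distribʳ-* (2 * l * l) V m) ⟨
      (2 * l * l * V) ^ m * f    ≤⟨ *-monoˡ-≤ f (^-monoˡ-≤ m (power-t v t w≡)) ⟩
      (K * W) ^ m * f            ≡⟨ cong (_* f) (^-distribʳ-* K W m) ⟩
      K ^ m * W ^ m * f          ≡⟨ poly₁ (K ^ m) (W ^ m) f ⟩
      K ^ m * f * W ^ m          ≤⟨ *-monoˡ-≤ (W ^ m) K^m≤ ⟩
      e * B * W ^ m              ≡⟨ poly₂ e B (W ^ m) ⟩
      B * (e * W ^ m)            ∎)
    where
    open ≤-Reasoning
    B = (2 * l * l) ^ m
    V = v ^ t
    W = suc v ^ t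
    poly₁ : ∀ x y z → x * y * z ≡ x * z * y
    poly₁ = solve-∀
    poly₂ : ∀ x y z → x * y * z ≡ y * (x * z)
    poly₂ = solve-∀

  -- The recursion leads from l t to (m + l) t, and monotonicity from there to `s`. The numerical
  -- hypothesis says that (1 + (e/f)(a/b))/(l t) is at most (a′/b′)/s.
  ladder : ∀ {a b a′ b′} t s .{{_ : NonZero t}} .{{_ : NonZero b}} → (m + l) * t ≤ s →
           (f * b + e * a) * b′ * s ≤ a′ * (f * b * l) * t →
           Density≤ (l * t) a (b * (l * t)) → Density≤ s a′ (b′ * s)
  ladder {a} {b} {a′} {b′} t s κt≤s x≤y D =
    weaken {{m*n≢0 (f * b) (l * t) {{m*n≢0 f b}}}}
      (subst₂ _≤_ (*-assoc (f * b + e * a) b′ s) (poly a′ (f * b) l t) x≤y)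
      (density-mono {{mt+lt≢0}}
        (≤-trans (≤-reflexive (sym (*-distribʳ-+ t m l))) κt≤s)
        (subst (λ w → Density≤ (m * t + w) (f * b + e * a) (f * b * w)) w≡
          (density-step-1/s {a = a} {e = e} (m * t) (power-mt (pred (l * t)) t w≡)
            (subst (λ w → Density≤ w a (b * w)) (sym w≡) D))))
    where
    instance
      lt≢0 : NonZero (l * t)
      lt≢0 = m*n≢0 l t
    mt+lt≢0 : NonZero (m * t + l * t)
    mt+lt≢0 = >-nonZero (≤-trans (>-nonZero⁻¹ (l * t)) (m≤n+m (l * t) (m * t)))
    w≡ : suc (pred (l * t)) ≡ l * t
    w≡ = suc-pred (l * t)
    poly : ∀ a b l t → a * (b * l) * t ≡ a * (b * (l * t))
    poly = solve-∀

  -- With t the integer part of s/(m + l), the ratio s/t tends to m + l, so a strict inequality at m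
  -- + l absorbs the rounding for large s.
  ladder-eventually : ∀ {a b a′ b′} .{{_ : NonZero b}} .{{_ : NonZero (m + l)}} →
                      (f * b + e * a) * b′ * (m + l) < a′ * (f * b * l) →
                      Eventually≤ a b → Eventually≤ a′ b′
  ladder-eventually {a} {b} {a′} {b′} xκ<y (N , D) = κ * M , λ s M≤s →
    let t   = s / κ
        M≤t = ≤-trans (≤-reflexive (sym (trans (cong (_/ κ) (*-comm κ M)) (m*n/n≡m M κ)))) (/-monoˡ-≤ κ M≤s)
        instance t≢0 = >-nonZero (≤-trans (s≤s z≤n) M≤t)
    in ladder t s (κt≤s s κ)
         (bound (s≤κt+κ s κ) (≤-trans (≤-trans (m≤n+m (x * κ) N) (n≤1+n (N + x * κ))) M≤t))
         (D (l * t) (≤-trans (≤-trans (≤-trans (m≤m+n N (x * κ)) (n≤1+n (N + x * κ))) M≤t) (m≤n*m t l)))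
    where
    open ≤-Reasoning
    κ x y M : ℕ
    κ = m + l
    x = (f * b + e * a) * b′
    y = a′ * (f * b * l)
    -- From t ≥ `M` follow t > 0, l t ≥ `N` and t ≥ `x * κ`, the last being what `bound` needs.
    M = suc (N + x * κ)
    bound : ∀ {s t} → s ≤ κ * t + pred κ → x * κ ≤ t → x * s ≤ y * t
    bound {s} {t} s≤ xκ≤t = begin
      x * s                ≤⟨ *-monoʳ-≤ x (≤-trans s≤ (+-monoʳ-≤ (κ * t) (pred[n]≤n))) ⟩
      x * (κ * t + κ)      ≡⟨ distrib x κ t ⟩
      x * κ * t + x * κ    ≤⟨ +-monoʳ-≤ (x * κ * t) xκ≤t ⟩
      x * κ * t + t        ≡⟨ +-comm _ t ⟩
      suc (x * κ) * t      ≤⟨ *-monoˡ-≤ t xκ<y ⟩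
      y * t                ∎
      where
      distrib : ∀ x k t → x * (k * t + k) ≡ x * k * t + x * k
      distrib = solve-∀

  -- An explicit variant: the rounding is paid for by a rational q/p bounding s/t.
  ladder-linear : ∀ {a b a′ b′} p q t s .{{_ : NonZero p}} .{{_ : NonZero t}} .{{_ : NonZero b}} →
                  (m + l) * t ≤ s → p * s ≤ q * t →
                  (f * b + e * a) * b′ * q ≤ a′ * (f * b * l) * p →
                  Density≤ (l * t) a (b * (l * t)) → Density≤ s a′ (b′ * s)
  ladder-linear {a} {b} {a′} {b′} p q t s κt≤s ps≤qt xq≤yp = ladder {a} {b} {a′} {b′} t s κt≤s (*-linear-≤ {p} {q} {(f * b + e * a) * b′} {a′ * (f * b * l)} ps≤qt xq≤yp)

-- The two numerical bounds

-- For numerals the hidden argument evaluates to the unit type and is filled in automatically.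
≤! : ∀ {m n} {m≤n : T (m ≤ᵇ n)} → m ≤ n
≤! {m} {n} {m≤n} = ≤ᵇ⇒≤ m n m≤n

-- One step from D(1) ≤ 1 gives p + (1-p)^j for D(j+1), hence for all larger s. Since 6.239/s
-- decreases, checking s = `hi` suffices.
density-small : ∀ u v j hi .{{_ : NonZero (u + v)}} → let w = u + v in
  {T ((u * w ^ j * 1 + v ^ j * 1 * w) * (1000 * hi) ≤ᵇ 6239 * (w * w ^ j * 1))} →
  ∀ {s} → suc j ≤ s → s ≤ hi → Density≤ s 6239 (1000 * s)
density-small u v j hi {ok} {s} j<s s≤hi =
  weaken {{m*n≢0 (w * w ^ j) 1 {{m*n≢0 w (w ^ j) {{it}} {{m^n≢0 w j}}}}}}
    (≤-trans (*-monoʳ-≤ a (*-monoʳ-≤ 1000 s≤hi)) (≤ᵇ⇒≤ (a * (1000 * hi)) _ ok))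
    (density-mono {{>-nonZero (m≤n+m 1 j)}} (≤-trans (≤-reflexive (+-comm j 1)) j<s)
      (density-step u v {v ^ j} {w ^ j} j ≤-refl density-one))
  where
  w = u + v
  a = u * w ^ j * 1 + v ^ j * 1 * w

-- The induction step takes c = 5/2, s = 2t and N = 7t; it needs t ≥ 8, and the
-- smaller values come from D(j+1) ≤ p + (1-p)^j.
density-all : ∀ s → 1 ≤ s → Density≤ s 6239 (1000 * s)
density-all = <-rec _ λ s rec 1≤s → go s rec 1≤s
  where
  -- Here K/(2l²) = 5/8, and (5/8)^5 = 0.09536... is rounded up to 0.0954.
  module L = Ladder 2 5 5 954 10000 refl ≤!
  go : ∀ s → (∀ {t} → t < s → 1 ≤ t → Density≤ t 6239 (1000 * t)) → 1 ≤ s → Density≤ s 6239 (1000 * s)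
  go s rec 1≤s with s ≤? 6 | s ≤? 13 | s ≤? 23 | s ≤? 34 | s ≤? 46 | s ≤? 59
  -- The first range takes p = 0, giving the trivial bound 1 ≤ 6.239/6. In each later range j + 1 is
  -- the upper end of the range before.
  ... | yes ≤6 | _      | _      | _      | _      | _      = density-small 0 1 0 6 1≤s ≤6
  ... | no 6≱  | yes ≤13 | _      | _      | _      | _      = density-small 1 2 5 13 (<⇒≤ (≰⇒> 6≱)) ≤13
  ... | _      | no 13≱ | yes ≤23 | _      | _      | _      = density-small 1 4 12 23 (<⇒≤ (≰⇒> 13≱)) ≤23
  ... | _      | _      | no 23≱ | yes ≤34 | _      | _      = density-small 1 7 22 34 (<⇒≤ (≰⇒> 23≱)) ≤34
  ... | _      | _      | _      | no 34≱ | yes ≤46 | _      = density-small 1 9 33 46 (<⇒≤ (≰⇒> 34≱)) ≤46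
  ... | _      | _      | _      | _      | no 46≱ | yes ≤59 = density-small 1 11 45 59 (<⇒≤ (≰⇒> 46≱)) ≤59
  ... | _      | _      | _      | _      | _      | no 59≱ =
    -- As t ≥ 8, s ≤ 7t + 6 ≤ (62/8) t; and (62/16)(1 + 0.0954 · 6.239) is about 6.18, below 6.239.
    L.ladder-linear {6239} {1000} {6239} {1000} 8 62 t s (κt≤s s 7) 8s≤62t ≤! (rec 2t<s (≤-trans (≤-trans (≤! {1} {8}) 8≤t) (m≤n*m t 2)))
    where
    open ≤-Reasoning
    t = s / 7
    8≤t : 8 ≤ t
    8≤t = /-monoˡ-≤ {56} 7 (≤-trans (≤! {56} {60}) (≰⇒> 59≱))
    instance
      t≢0 : NonZero t
      t≢0 = >-nonZero (≤-trans (≤! {1} {8}) 8≤t)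
    2t<s : 2 * t < s
    2t<s = <-≤-trans (*-monoˡ-< t (≤! {3} {7})) (κt≤s s 7)
    8s≤62t : 8 * s ≤ 62 * t
    8s≤62t = begin
      8 * s             ≤⟨ *-monoʳ-≤ 8 (s≤κt+κ s 7) ⟩
      8 * (7 * t + 6)   ≡⟨ distrib 8 7 t 6 ⟩
      56 * t + 6 * 8    ≤⟨ +-monoʳ-≤ (56 * t) (*-monoʳ-≤ 6 8≤t) ⟩
      56 * t + 6 * t    ≡⟨ *-distribʳ-+ t 56 6 ⟨
      62 * t            ∎
      where
      distrib : ∀ a b c d → a * (b * c + d) ≡ a * b * c + d * a
      distrib = solve-∀

-- Iterates M ↦ (7/2)(1 + 0.082086 M) from 6.239, where
-- (79601/80000)^500 ≤ 0.082086 approximates e^{-5/2}; each value is rounded up.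
eventually-4911 : Eventually≤ 4911 1000
eventually-4911 =
  improve 49112 10000 4911 1000 $
  improve 49117 10000 49112 10000 $
  improve 49136 10000 49117 10000 $
  improve 49202 10000 49136 10000 $
  improve 4943 1000 49202 10000 $
  improve 5021 1000 4943 1000 $
  improve 5293 1000 5021 1000 $
  improve 6239 1000 5293 1000 $
  (1 , density-all)
  where
  -- The ratio m/l is 5/2, and l = 200 is fine enough for the fixed point 3.5/(1 - 3.5 · 0.082086)
  -- to stay below 4.911.
  module L = Ladder 200 500 79601 82086 1000000 refl ≤!
  improve : ∀ a b a′ b′ .{{_ : NonZero b}} →
            -- The `suc` encodes the strict inequality that absorbs the rounding; 700 is m + l.
            {T (suc ((1000000 * b + 82086 * a) * b′ * 700) ≤ᵇ a′ * (1000000 * b * 200))} →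
            Eventually≤ a b → Eventually≤ a′ b′
  improve a b a′ b′ {ok} = L.ladder-eventually {a} {b} {a′} {b′} (≤ᵇ⇒≤ _ _ ok)

theorem1p1 : ((n r : ℕ) → 1 ≤ r → r < n →
    TuranLeFrac n (suc r) r (6239 * (n C r)) (1000 * suc r))
    × Σ ℕ (λ r₀ → (n r : ℕ) → 1 ≤ r → r₀ ≤ r → r < n →
    TuranLeFrac n (suc r) r (4911 * (n C r)) (1000 * suc r))
theorem1p1 =
  (λ n r _ _ → toTuran {r} {6239} (density-all (suc r) (s≤s z≤n)) n) ,
  let N , D = eventually-4911 in
  N , λ n r _ N≤r _ → toTuran {r} {4911} (D (suc r) (m≤n⇒m≤1+n N≤r)) n
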